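{- Let $\psi=\neg\mathrm{Contains}(\mathcal{N}_0,\mathcal{H}_0)\wedge\Phi_{\mathcal{L}}$ be a normalized constraint in which every variable of $\mathcal{N}_0$ is flat, let $\lambda_{\mathrm{Flat}}$ be the associated bound, let $\eta$ be an assignment of the variables of $\mathcal{N}_0$ to words, and let $\varphi = \psi_\eta = \neg\mathrm{Contains}(\mathcal{N},\mathcal{H})\wedge\Phi_{\mathcal{L},\eta}$ be the associated constraint (all defined in the context), where $\mathcal{N}$ contains at least one variable. Let $z$ be a (decomposed) non-flat variable occurring in $\mathcal{H}$, and let $\#$ be a fresh alphabet symbol. Then there is a flat language $\mathcal{L}^{\mathrm{Flat}}_z\subset\mathcal{L}_z$ such that if there exists a model $\sigma\models\varphi$, then there exists a model $\sigma'\models\varphi[z/z\#]$ such that $\sigma' = \sigma\triangleleft\{z\mapsto w_z\}$ for some word $w_z\in\mathcal{L}^{\mathrm{Flat}}_z$.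
   Context: Constraints. $\Sigma$ is a finite alphabet, $\mathbb{X}$ a set of string variables; terms are words over $\mathbb{X}\cup\Sigma$. A constraint is $\neg\mathrm{Contains}(\mathcal{N},\mathcal{H})\wedge\Phi_{\mathcal{L}}$ with terms $\mathcal{N},\mathcal{H}$ and $\Phi_{\mathcal{L}}=\bigwedge_{x}x\in\mathcal{L}_x$, all $\mathcal{L}_x\subseteq\Sigma^*$ regular. An assignment $\sigma$ maps variables to words of $\Sigma^*$ and is extended homomorphically to terms (symbols are mapped to themselves). $\sigma$ is a model of the constraint ($\sigma\models$) iff $\sigma(x)\in\mathcal{L}_x$ for every $x$ and $\sigma(\mathcal{N})$ is not a factor (contiguous subword) of $\sigma(\mathcal{H})$. $\sigma\triangleleft\{z\mapsto w\}$ is $\sigma$ with the value of $z$ changed to $w$. $\varphi[z/z\#]$ is obtained by replacing every occurrence of $z$ in the two terms by $z\#$, with $\#\notin\Sigma\cup\mathbb{X}$ (the variables' languages are unchanged). Flatness and normalization. A language is flat if it is a finite union of languages $w_1w_2^*w_3\cdots w_{\ell-1}^*w_\ell$ with words $w_j$; otherwise non-flat. A variable is flat / non-flat / finite if its language is. A variable is decomposed if its language is accepted by a DFA with a single initial state and a single final state, containing exactly one nontrivial maximal strongly connected component and no other SCCs. A constraint is normalized if it contains an occurrence of at least one variable, contains no finite variable, and all its variables are decomposed; after normalization every flat variable $x$ has a language of the form $\mathcal{L}_x=(\alpha^k)^*$ with $\alpha$ primitive (not of the form $v^i$ with $i>1$) and $k\ge 1$, and $\mathrm{Base}(x)=\{\alpha\}$.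 $\mathrm{Base}(\mathcal{N}_0)$ is the union of $\mathrm{Base}(x)$ over flat variables $x$ of $\mathcal{N}_0$. Words $\gamma_z$. For each non-flat variable $z$ of $\mathcal{H}_0$ with DFA $\mathcal{A}_z$ for $\mathcal{L}_z$, fix a state $q_{u|v}$ and words $u,v$, not both powers of a common word, such that $\mathcal{A}_z$ has runs over $u$ and over $v$ from $q_{u|v}$ to $q_{u|v}$; put $\gamma_z=u^{2+k}v^2$ for the minimal $k\in\mathbb{N}$ such that $|\gamma_z|>|\alpha|$ for all $\alpha\in\mathrm{Base}(\mathcal{N}_0)$. Bounds (for $\psi$). $M_{\mathrm{Lit}}$ is the length of the longest string literal (factor consisting of symbols of $\Sigma$ only) in $\mathcal{N}_0$ and $\mathcal{H}_0$; $M_Q$ is the largest number of states of a DFA associated with a variable; $M_\alpha$ is the length of the longest word in $\mathrm{Base}(\mathcal{N}_0)\cup\{\gamma_z : z \text{ a non-flat variable of } \mathcal{H}_0\}$. Then $\lambda_{Q}=2M_\alpha M_Q+M_{\mathrm{Lit}}$ and $\lambda_{\mathrm{Flat}}=\lambda_Q+4M_\alpha+M_Q$. The constraint $\psi_\eta$. Given $\eta$ assigning a word of $\Sigma^*$ to each variable of $\mathcal{N}_0$, $\psi_\eta$ is obtained from $\psi$ by replacing (in both terms) every variable $x$ of $\mathcal{N}_0$ with $|\eta(x)|<\lambda_{\mathrm{Flat}}$ by the word $\eta(x)$, and by replacing the language of each variable $y$ of $\mathcal{N}_0$ with $|\eta(y)|\ge\lambda_{\mathrm{Flat}}$ by $\mathcal{L}_y\cap\{w\in\Sigma^*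 : |w|\ge\lambda_{\mathrm{Flat}}\}$; other languages are unchanged. -}

module Defs where

open import Data.Bool using (if_then_else_)
open import Data.Fin using (Fin)
import Data.Fin as Fin
open import Data.Fin.Subset using (Subset; ⁅_⁆) renaming (_∈_ to _∈ₛ_)
open import Data.List using (List; []; _∷_; [_]; _++_; map; concat; concatMap; replicate; mapMaybe; length)
open import Data.List.Membership.Propositional using () renaming (_∈_ to _∈ₗ_)
import Data.List.Membership.DecPropositional as DecMembership
open import Data.List.Relation.Binary.Infix.Heterogeneous using (Infix)
open import Data.List.Relation.Unary.Any using (Any)
open import Data.Maybe using (Maybe; just; nothing; _>>=_)
open import Data.Nat using (ℕ; _+_; _*_; _≤_; _<_; _≥_; _>_; _<?_; _≤?_)
open import Data.Product using (∃; ∃₂; _×_; _,_)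
open import Data.Sum using (_⊎_; inj₁; inj₂; [_,_]′; isInj₁; map₂)
open import Function using (_∘_)
open import Level using (0ℓ)
open import Relation.Binary.PropositionalEquality using (_≡_)
open import Relation.Nullary using (¬_; does; _×-dec_)
open import Relation.Unary using (Pred; _∈_; _⊆_; _≐_; _∩_; ｛_｝)

private
  variable
    A : Set
    n : ℕ

------------------------------------------------------------------------
-- Words and languages

Word : Set → Set
Word A = List A

Language : Set → Set₁
Language A = Pred (Word A) 0ℓ

infixr 8 _^_
_^_ : Word A → ℕ → Word A
w ^ i = concat (replicate i w)

infix 9 _⋆
_⋆ : Word A → Language A
(w ⋆) v = ∃ λ i → v ≡ w ^ i

infixr 7 _·_
_·_ : Language A → Language A → Language A
(L · M) w = ∃₂ λ u v → w ≡ u ++ v × u ∈ L × v ∈ M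

Factor : Word A → Word A → Set
Factor = Infix _≡_

-- ε = ε ^ 2, so a primitive word is nonempty.
Primitive : Word A → Set
Primitive α = ¬ (∃₂ λ v i → i > 1 × α ≡ v ^ i)

PowersOfCommonWord : Word A → Word A → Set
PowersOfCommonWord u v = ∃ λ w → (∃ λ i → u ≡ w ^ i) × (∃ λ j → v ≡ w ^ j)

Finite : Language A → Set
Finite L = ∃ λ ws → ∀ {w} → w ∈ L → w ∈ₗ ws

-- w₁ w₂* w₃ w₄* … w_ℓ is  w₁ ∙ w₂ *∙ (w₃ ∙ w₄ *∙ … (last w_ℓ)).
data Chain (A : Set) : Set where
  last   : Word A → Chain A
  _∙_*∙_ : Word A → Word A → Chain A → Chain A

chain : Chain A → Language A
chain (last w)     = ｛ w ｝
chain (w ∙ v *∙ c) = ｛ w ｝ · v ⋆ · chain c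

Flat : Language A → Set
Flat L = ∃ λ cs → L ≐ λ w → Any (λ c → w ∈ chain c) cs

------------------------------------------------------------------------
-- Automata

-- Transitions are partial: a completing sink state would itself form a
-- second strongly connected component.
record DFA (A : Set) : Set where
  field
    states : ℕ
    δ      : Fin states → A → Maybe (Fin states)
    init   : Fin states
    final  : Subset states

  State : Set
  State = Fin states

  δ* : State → Word A → Maybe State
  δ* q []      = just q
  δ* q (a ∷ w) = δ q a >>= λ r → δ* r w

  Run : State → Word A → State → Set
  Run q w r = δ* q w ≡ just r

  accepted : Language A
  accepted w = ∃ λ f → f ∈ₛ final × Run init w f

  Reachable : State → State → Set
  Reachable p q = ∃ λ w → Run p w q

  -- The maximal strongly connected component of a state.
  SCC : State → Pred State 0ℓ
  SCC p q = Reachable p q × Reachable q p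

  Nontrivial : Pred State 0ℓ → Set
  Nontrivial C = ∃₂ λ p q → p ∈ C × q ∈ C × ∃ λ a → δ p a ≡ just q

  SingleFinalState : Set
  SingleFinalState = ∃ λ f → final ≡ ⁅ f ⁆

  SingleNontrivialSCC : Set
  SingleNontrivialSCC = ∃ λ p → Nontrivial (SCC p) × (∀ q → SCC q ≐ SCC p)

open DFA

record DecomposedBy (𝒜 : DFA A) (L : Language A) : Set where
  field
    recognises  : L ≐ accepted 𝒜
    singleFinal : SingleFinalState 𝒜
    singleSCC   : SingleNontrivialSCC 𝒜

------------------------------------------------------------------------
-- Terms, constraints, models

Term : Set → ℕ → Set
Term A n = List (Fin n ⊎ A)

vars : Term A n → List (Fin n)
vars = mapMaybe isInj₁

literal : Word A → Term A n
literal = map inj₂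

replace : (Fin n → Term A n) → Term A n → Term A n
replace ρ = concatMap [ ρ , (λ a → [ inj₂ a ]) ]′

Assignment : Set → ℕ → Set
Assignment A n = Fin n → Word A

_⟨_⟩ : Assignment A n → Term A n → Word A
σ ⟨ t ⟩ = concatMap [ σ , [_] ]′ t

_◁_↦_ : Assignment A n → Fin n → Word A → Assignment A n
(σ ◁ z ↦ w) x = if does (x Fin.≟ z) then w else σ x

-- ¬Contains(needle, haystack) ∧ ⋀ₓ x ∈ lang x
record Constraint (A : Set) (n : ℕ) : Set₁ where
  constructor ¬Contains
  field
    needle haystack : Term A n
    lang            : Fin n → Language A

open Constraint

infix 4 _⊨_
_⊨_ : Assignment A n → Constraint A n → Set
σ ⊨ φ = (∀ x → σ x ∈ lang φ x) × ¬ Factor (σ ⟨ needle φ ⟩) (σ ⟨ haystack φ ⟩)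

-- The alphabet extended by the fresh symbol # is Maybe A, with # = nothing.
embed : Assignment A n → Assignment (Maybe A) n
embed σ x = map just (σ x)

_[_/_#] : Constraint A n → Fin n → Fin n → Constraint (Maybe A) n
_[_/_#] {A} {n} φ z y = ¬Contains (term (needle φ)) (term (haystack φ))
                                   (λ x w → ∃ λ v → v ∈ lang φ x × w ≡ map just v)
  where
  ρ : Fin n → Term (Maybe A) n
  ρ x = if does (x Fin.≟ z) then inj₁ y ∷ inj₂ nothing ∷ [] else [ inj₁ x ]

  term : Term A n → Term (Maybe A) n
  term t = replace ρ (map (map₂ just) t)

------------------------------------------------------------------------
-- Normalization

HasBase : Language A → Word A → Set
HasBase L α = Primitive α × ∃ λ k → k ≥ 1 × L ≐ (α ^ k) ⋆

record Normalized (ψ : Constraint A n) (𝒜 : Fin n → DFA A) : Set where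
  field
    hasVariable : ∃ λ x → x ∈ₗ vars (needle ψ ++ haystack ψ)
    notFinite   : ∀ x → ¬ Finite (lang ψ x)
    decomposed  : ∀ x → DecomposedBy (𝒜 x) (lang ψ x)
    flatForm    : ∀ x → Flat (lang ψ x) → ∃ (HasBase (lang ψ x))

Base : Constraint A n → Pred (Word A) 0ℓ
Base ψ α = ∃ λ x → x ∈ₗ vars (needle ψ) × Flat (lang ψ x) × HasBase (lang ψ x) α

------------------------------------------------------------------------
-- The words γ and the bounds

IsMinimum IsMaximum : Pred ℕ 0ℓ → ℕ → Set
IsMinimum P m = P m × (∀ {i} → P i → m ≤ i)
IsMaximum P m = P m × (∀ {i} → P i → i ≤ m)

NonFlatHaystackVar : Constraint A n → Fin n → Set
NonFlatHaystackVar ψ z = z ∈ₗ vars (haystack ψ) × ¬ Flat (lang ψ z)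

record IsGamma (ψ : Constraint A n) (𝒜 : DFA A) (g : Word A) : Set where
  field
    u v            : Word A
    state          : State 𝒜
    loop-u         : Run 𝒜 state u state
    loop-v         : Run 𝒜 state v state
    notCommonPower : ¬ PowersOfCommonWord u v
    k              : ℕ
    k-minimal      : IsMinimum (λ i → ∀ {α} → α ∈ Base ψ → length (u ^ (2 + i) ++ v ^ 2) > length α) k
    g-def          : g ≡ u ^ (2 + k) ++ v ^ 2

-- Values of γ at variables that are not non-flat variables of the haystack
-- are irrelevant.
GammaChoice : (ψ : Constraint A n) (𝒜 : Fin n → DFA A) (γ : Fin n → Word A) → Set
GammaChoice ψ 𝒜 γ = ∀ z → NonFlatHaystackVar ψ z → IsGamma ψ (𝒜 z) (γ z)

record Bounds (ψ : Constraint A n) (𝒜 : Fin n → DFA A) (γ : Fin n → Word A) : Set where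
  field
    M-Lit M-Q M-α : ℕ
    isM-Lit : IsMaximum
      (λ m → ∃ λ w → (Factor (literal w) (needle ψ) ⊎ Factor (literal w) (haystack ψ)) × m ≡ length w)
      M-Lit
    isM-Q   : IsMaximum (λ m → ∃ λ x → m ≡ states (𝒜 x)) M-Q
    isM-α   : IsMaximum
      (λ m → ∃ λ w → (w ∈ Base ψ ⊎ (∃ λ z → NonFlatHaystackVar ψ z × w ≡ γ z)) × m ≡ length w)
      M-α

  λ-Q λ-Flat : ℕ
  λ-Q    = 2 * M-α * M-Q + M-Lit
  λ-Flat = λ-Q + 4 * M-α + M-Q

-- The constraint ψ_η for the length bound ℓ; only the values of η at the
-- variables of the needle matter.
instantiate : Constraint A n → ℕ → Assignment A n → Constraint A n
instantiate {A} {n} ψ ℓ η = ¬Contains (replace ρ (needle ψ)) (replace ρ (haystack ψ)) lang′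
  where
  open DecMembership (Fin._≟_ {n}) using (_∈?_)

  ρ : Fin n → Term A n
  ρ x = if does (x ∈? vars (needle ψ) ×-dec length (η x) <? ℓ)
          then literal (η x) else [ inj₁ x ]

  lang′ : Fin n → Language A
  lang′ x = if does (x ∈? vars (needle ψ) ×-dec ℓ ≤? length (η x))
              then lang ψ x ∩ (λ w → ℓ ≤ length w) else lang ψ x

{-# OPTIONS --safe #-}
-- Every accepted value y of z can be replaced by an accepted word w of the form
-- vʲp with |v|, |p| ≤ K, where K does not depend on σ, such that for every T an
-- occurrence of N = σ(𝒩) in Tw yields one in Ty.  The words vʲp of L_z with v and
-- p bounded form a flat language, because the states reached by the powers of v
-- are eventually periodic.  To find w, strip the variables of 𝒩 from the right,
-- N = N′ σ(x) ℓ with |ℓ| ≤ c.  If σ(x) is short, it is absorbed into ℓ.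
-- Otherwise let d be the period of σ(x) and y = u a p p′ with u the longest
-- d-periodic prefix and |p| = c, and take w = u a p r with r a short path to the
-- final state: an occurrence of N that ends in r would make σ(x) cover a and the
-- letter d places before it, which differ.  Once no variable is left, N is short,
-- and y is shortened by cutting between two prefixes that reach the same state
-- and end in the same c letters.
module Submission where

open import Defs
open import Data.Bool using (true; false; if_then_else_)
open import Data.Nat using (ℕ; zero; suc; _+_; _*_; _∸_; _⊓_; _≤_; _<_; _≥_; _>_; z≤n; s≤s; _≤?_; _<?_; NonZero; >-nonZero)
open import Data.Nat.DivMod using (_/_; _%_; m≡m%n+[m/n]*n; m%n<n)
open import Data.Nat.Induction using (<-wellFounded)
open import Data.Nat.Properties
open import Data.Fin using (Fin; toℕ)
import Data.Fin as Fin
import Data.Fin.Properties as Fin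
open import Data.Fin.Subset using () renaming (_∈_ to _∈ₛ_)
open import Data.Fin.Subset.Properties using (x∈⁅x⁆) renaming (_∈?_ to _∈ₛ?_)
open import Data.Product using (∃; ∃₂; Σ-syntax; ∃-syntax; _×_; _,_; proj₁; proj₂)
open import Data.Sum using (_⊎_; inj₁; inj₂; map₂) renaming (map to map-⊎)
open import Data.List using (List; []; _∷_; [_]; _++_; length; map; filter; allFin; upTo; cartesianProduct; cartesianProductWith; take; drop)
open import Data.List.Extrema.Nat using (max; xs≤max)
open import Data.List.Membership.Propositional using (find; lose) renaming (_∈_ to _∈ₗ_; _∉_ to _∉ₗ_)
import Data.List.Membership.DecPropositional as DecMembership
open import Data.List.Membership.Propositional.Properties
open import Data.List.Membership.Setoid.Properties using (index-injective)
open import Data.List.Properties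
import Data.List.Relation.Binary.Infix.Heterogeneous as Infix
import Data.List.Relation.Binary.Infix.Heterogeneous.Properties as Infix
open import Data.List.Relation.Binary.Pointwise using (≡⇒Pointwise-≡; Pointwise-≡⇒≡)
open import Data.List.Relation.Binary.Prefix.Heterogeneous using (Prefix; []; _∷_)
import Data.List.Relation.Unary.All as All
open import Data.List.Relation.Unary.Any using (Any; here; there; index)
open import Data.List.Reverse using (Reverse; []; _∶_∶ʳ_; reverseView)
open import Data.Maybe using (Maybe; just; nothing; _>>=_)
import Data.Maybe.Properties as Maybe
open import Function using (_∘_; id)
open import Induction.WellFounded using (Acc; acc)
open import Relation.Binary.Definitions using (DecidableEquality)
open import Relation.Binary.PropositionalEquality hiding ([_])
open import Relation.Nullary using (¬_; Dec; yes; no; does; contradiction; _×-dec_; map′)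
open import Relation.Unary using (_∈_; _⊂_; _⊆_)

private
  variable
    A B : Set

-- Factors and comparison of two factorizations of one word.

toFactor : ∀ {N W : Word A} B C → W ≡ B ++ N ++ C → Factor N W
toFactor B C refl = Infix.fromView (Infix.MkView B (≡⇒Pointwise-≡ refl) C)

fromFactor : {N W : Word A} → Factor N W → ∃₂ λ B C → W ≡ B ++ N ++ C
fromFactor f with Infix.toView f
... | Infix.MkView B eq C rewrite Pointwise-≡⇒≡ eq = B , C , refl

split-prefix : ∀ (xs xs′ : List A) {ys ys′} → xs ++ ys ≡ xs′ ++ ys′ → length xs ≤ length xs′ →
               ∃ λ m → xs′ ≡ xs ++ m × ys ≡ m ++ ys′
split-prefix []       xs′        eq _        = xs′ , refl , eq
split-prefix (x ∷ xs) (x′ ∷ xs′) eq (s≤s le) with ∷-injective eq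
... | refl , eq′ with m , p , q ← split-prefix xs xs′ eq′ le = m , cong (x ∷_) p , q

-- Both factorizations have the same total length, so the one with the shorter suffix has the longer
-- prefix.
split-suffix : ∀ (xs xs′ : List A) {ys ys′} → xs ++ ys ≡ xs′ ++ ys′ → length ys′ ≤ length ys →
               ∃ λ m → xs′ ≡ xs ++ m × ys ≡ m ++ ys′
split-suffix xs xs′ {ys} {ys′} eq le = split-prefix xs xs′ eq (+-cancelʳ-≤ (length ys) _ _ (begin
  length xs + length ys    ≡⟨ length-++ xs ⟨
  length (xs ++ ys)        ≡⟨ cong length eq ⟩
  length (xs′ ++ ys′)      ≡⟨ length-++ xs′ ⟩
  length xs′ + length ys′  ≤⟨ +-monoʳ-≤ (length xs′) le ⟩
  length xs′ + length ys   ∎))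
  where open ≤-Reasoning

length-++-mono-≤ : ∀ (xs xs′ : List A) {ys ys′ : List A} → length xs ≤ length xs′ → length ys ≤ length ys′ →
                   length (xs ++ ys) ≤ length (xs′ ++ ys′)
length-++-mono-≤ xs xs′ le le′ =
  subst₂ _≤_ (sym (length-++ xs)) (sym (length-++ xs′)) (+-mono-≤ le le′)

letter-unique : ∀ (xs xs′ : List A) {a a′ ys ys′} → xs ++ a ∷ ys ≡ xs′ ++ a′ ∷ ys′ →
                length xs ≡ length xs′ → a ≡ a′
letter-unique []       []         eq _  = proj₁ (∷-injective eq)
letter-unique (x ∷ xs) (x′ ∷ xs′) eq le =
  letter-unique xs xs′ (proj₂ (∷-injective eq)) (suc-injective le)

prefix-of-length : ∀ n (xs : List A) → n ≤ length xs →
                   ∃₂ λ ys zs → xs ≡ ys ++ zs × length ys ≡ n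
prefix-of-length zero    xs       _        = [] , xs , refl , refl
prefix-of-length (suc n) (x ∷ xs) (s≤s le) with ys , zs , refl , eq ← prefix-of-length n xs le =
  x ∷ ys , zs , refl , cong suc eq

-- Powers and periods

^-+ : ∀ (v : Word A) m n → v ^ (m + n) ≡ v ^ m ++ v ^ n
^-+ v zero    n = refl
^-+ v (suc m) n = trans (cong (v ++_) (^-+ v m n)) (sym (++-assoc v (v ^ m) (v ^ n)))

^-* : ∀ (v : Word A) m n → v ^ (n * m) ≡ (v ^ m) ^ n
^-* v m zero    = refl
^-* v m (suc n) = trans (^-+ v m (n * m)) (cong (v ^ m ++_) (^-* v m n))

^-comm : ∀ (v : Word A) n → v ++ v ^ n ≡ v ^ n ++ v
^-comm v zero    = ++-identityʳ v
^-comm v (suc n) = trans (cong (v ++_) (^-comm v n)) (sym (++-assoc v (v ^ n) v))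

-- Stated by factorizations instead of indices, so that a mismatching pair of letters refutes it
-- directly. Words of length at most `d` satisfy it vacuously.
Periodic : ℕ → Word A → Set
Periodic d w = ∀ s₁ b s₂ a s₃ → w ≡ s₁ ++ b ∷ s₂ ++ a ∷ s₃ → length (b ∷ s₂) ≡ d → b ≡ a

-- Since `v` commutes with `v ^ n`, prepending `v` to the word gives the same result as appending
-- it. The position after `v ++ s₁` then holds `b` in one reading and `a` in the other.
^-periodic : ∀ (v : Word A) n → Periodic (length v) (v ^ n)
^-periodic v n s₁ b s₂ a s₃ eq len = letter-unique (v ++ s₁) (s₁ ++ b ∷ s₂) shifted lengths
  where
  open ≡-Reasoning
  shifted : (v ++ s₁) ++ b ∷ s₂ ++ a ∷ s₃ ≡ (s₁ ++ b ∷ s₂) ++ a ∷ s₃ ++ v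
  shifted = begin
    (v ++ s₁) ++ b ∷ s₂ ++ a ∷ s₃    ≡⟨ ++-assoc v s₁ _ ⟩
    v ++ s₁ ++ b ∷ s₂ ++ a ∷ s₃      ≡⟨ cong (v ++_) eq ⟨
    v ++ v ^ n                       ≡⟨ ^-comm v n ⟩
    v ^ n ++ v                       ≡⟨ cong (_++ v) eq ⟩
    (s₁ ++ b ∷ s₂ ++ a ∷ s₃) ++ v    ≡⟨ ++-assoc s₁ _ v ⟩
    s₁ ++ (b ∷ s₂ ++ a ∷ s₃) ++ v    ≡⟨ cong (λ t → s₁ ++ b ∷ t) (++-assoc s₂ _ v) ⟩
    s₁ ++ b ∷ s₂ ++ a ∷ s₃ ++ v      ≡⟨ ++-assoc s₁ _ _ ⟨
    (s₁ ++ b ∷ s₂) ++ a ∷ s₃ ++ v    ∎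
  lengths : length (v ++ s₁) ≡ length (s₁ ++ b ∷ s₂)
  lengths = begin
    length (v ++ s₁)                 ≡⟨ length-++ v ⟩
    length v + length s₁             ≡⟨ +-comm (length v) _ ⟩
    length s₁ + length v             ≡⟨ cong (length s₁ +_) len ⟨
    length s₁ + length (b ∷ s₂)      ≡⟨ length-++ s₁ ⟨
    length (s₁ ++ b ∷ s₂)            ∎

-- The mismatch b ≢ a at distance d cannot lie within the d-periodic X.  But X
-- is too long to start behind b, so an occurrence of N′Xℓ has to end before r.
occurrence-before-tail :
  ∀ {d} (T u₁ : Word A) b u₂ a p r N′ X ℓ →
  b ≢ a → length (b ∷ u₂) ≡ d → Periodic d X →
  length ℓ ≤ length p → d + suc (length p + length r) ≤ length X →
  let y = u₁ ++ b ∷ u₂ ++ a ∷ p in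
  Factor (N′ ++ X ++ ℓ) (T ++ y ++ r) → Factor (N′ ++ X ++ ℓ) (T ++ y)
occurrence-before-tail {d = d} T u₁ b u₂ a p r N′ X ℓ b≢a len perX ℓ≤p X≥ f
  with B , C , eq ← fromFactor f | length r ≤? length C
... | yes r≤C = toFactor B m (trans eq₁ (++-assoc B _ m))
  where
  N = N′ ++ X ++ ℓ
  y = u₁ ++ b ∷ u₂ ++ a ∷ p
  cut = split-suffix (B ++ N) (T ++ y) {C} {r}
          (trans (++-assoc B N C) (trans (sym eq) (sym (++-assoc T y r)))) r≤C
  m = proj₁ cut
  eq₁ = proj₁ (proj₂ cut)
... | no r≰C = contradiction (perX m b u₂ a m′ X≡ len) b≢a
  where
  y = u₁ ++ b ∷ u₂ ++ a ∷ p
  M = b ∷ u₂ ++ [ a ]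
  E = p ++ r
  D = ℓ ++ C

  -- The same word is factorized around `X` and around the window `M` from `b` to `a`. By `D≤E`, `X`
  -- ends no earlier than `M`; by `ME≤XD`, it starts no later. Hence `M` is a factor of `X`.
  eq′ : (B ++ N′) ++ X ++ D ≡ (T ++ u₁) ++ M ++ E
  eq′ = begin
    (B ++ N′) ++ X ++ D              ≡⟨ ++-assoc B N′ _ ⟩
    B ++ N′ ++ X ++ ℓ ++ C           ≡⟨ cong (λ t → B ++ N′ ++ t) (++-assoc X ℓ C) ⟨
    B ++ N′ ++ (X ++ ℓ) ++ C         ≡⟨ cong (B ++_) (++-assoc N′ (X ++ ℓ) C) ⟨
    B ++ (N′ ++ X ++ ℓ) ++ C         ≡⟨ eq ⟨
    T ++ y ++ r                      ≡⟨ cong (T ++_) (++-assoc u₁ _ r) ⟩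
    T ++ u₁ ++ b ∷ (u₂ ++ a ∷ p) ++ r ≡⟨ cong (λ t → T ++ u₁ ++ b ∷ t) (++-assoc u₂ _ r) ⟩
    T ++ u₁ ++ b ∷ u₂ ++ a ∷ p ++ r  ≡⟨ cong (λ t → T ++ u₁ ++ b ∷ t) (++-assoc u₂ [ a ] _) ⟨
    T ++ u₁ ++ M ++ E                ≡⟨ ++-assoc T u₁ _ ⟨
    (T ++ u₁) ++ M ++ E              ∎
    where open ≡-Reasoning

  D≤E : length D ≤ length E
  D≤E = length-++-mono-≤ ℓ p ℓ≤p (<⇒≤ (≰⇒> r≰C))

  ME≤XD : length (M ++ E) ≤ length (X ++ D)
  ME≤XD = begin
    length (M ++ E)                                ≡⟨ length-++ M ⟩
    length M + length E                            ≡⟨ cong (_+ length E) (length-++ (b ∷ u₂)) ⟩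
    length (b ∷ u₂) + 1 + length E                 ≡⟨ cong (λ t → t + 1 + length E) len ⟩
    d + 1 + length E                               ≡⟨ +-assoc d 1 _ ⟩
    d + suc (length E)                             ≡⟨ cong (λ t → d + suc t) (length-++ p) ⟩
    d + suc (length p + length r)                  ≤⟨ X≥ ⟩
    length X                                       ≤⟨ m≤m+n _ _ ⟩
    length X + length D                            ≡⟨ length-++ X ⟨
    length (X ++ D)                                ∎
    where open ≤-Reasoning

  cut₁ = split-suffix (B ++ N′) (T ++ u₁) eq′ ME≤XD
  m = proj₁ cut₁

  cut₂ = split-suffix (m ++ M) X
           (trans (++-assoc m M E) (sym (proj₂ (proj₂ cut₁)))) D≤E
  m′ = proj₁ cut₂

  X≡ : X ≡ m ++ b ∷ u₂ ++ a ∷ m′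
  X≡ = trans (proj₁ (proj₂ cut₂)) (trans (++-assoc m M m′) (cong (λ t → m ++ b ∷ t) (++-assoc u₂ [ a ] m′)))

-- Comparing a word with the powers of another word.

data Compare (v y : Word A) : Set where
  prefix   : ∀ y′ → y ≡ v ++ y′ → Compare v y
  shorter  : length y ≤ length v → Compare v y
  mismatch : ∀ v₁ b v₂ a y′ → v ≡ v₁ ++ b ∷ v₂ → y ≡ v₁ ++ a ∷ y′ → b ≢ a → Compare v y

-- In `broken`, one full period before the letter `a` stands `b`, provided that another copy of `v`
-- precedes. In `short` only the length of `p` is recorded: such a remainder is kept as the tail of
-- `vʲp`, whatever its letters.
data Stripped (v y : Word A) : Set where
  short  : ∀ j p → y ≡ v ^ j ++ p → length p ≤ length v → Stripped v y
  broken : ∀ j v₁ b v₂ a p → v ≡ v₁ ++ b ∷ v₂ → y ≡ v ^ j ++ v₁ ++ a ∷ p → b ≢ a → Stripped v y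

module _ (_≟ᴬ_ : DecidableEquality A) where

  compareWith : ∀ v y → Compare {A} v y
  compareWith []      y  = prefix y refl
  compareWith (b ∷ v) [] = shorter z≤n
  compareWith (b ∷ v) (a ∷ y) with b ≟ᴬ a
  ... | no b≢a = mismatch [] b v a y refl refl b≢a
  ... | yes refl with compareWith v y
  ...   | prefix y′ eq  = prefix y′ (cong (b ∷_) eq)
  ...   | shorter le    = shorter (s≤s le)
  ...   | mismatch v₁ b′ v₂ a′ y′ eq₁ eq₂ b≢a =
            mismatch (b ∷ v₁) b′ v₂ a′ y′ (cong (b ∷_) eq₁) (cong (b ∷_) eq₂) b≢a

  strip-powers : ∀ v y → length v > 0 → Stripped {A} v y
  strip-powers v y v>0 = go y (<-wellFounded (length y))
    where
    prepend : ∀ y → Stripped v y → Stripped v (v ++ y)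
    prepend y (short j p eq le) =
      short (suc j) p (trans (cong (v ++_) eq) (sym (++-assoc v (v ^ j) p))) le
    prepend y (broken j v₁ b v₂ a p eq₁ eq₂ b≢a) =
      broken (suc j) v₁ b v₂ a p eq₁ (trans (cong (v ++_) eq₂) (sym (++-assoc v (v ^ j) _))) b≢a

    go : ∀ y → Acc _<_ (length y) → Stripped v y
    go y (acc rec) with compareWith v y
    ... | shorter le = short 0 y refl le
    ... | mismatch v₁ b v₂ a p eq₁ eq₂ b≢a = broken 0 v₁ b v₂ a p eq₁ eq₂ b≢a
    ... | prefix y′ refl =
      prepend y′ (go y′ (rec (subst (length y′ <_) (sym (length-++ v)) (m<n+m (length y′) v>0))))

-- Automata

pigeonhole-∈ : ∀ (xs : List B) (f : ℕ → B) → (∀ i → f i ∈ₗ xs) →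
               ∃₂ λ i j → i < j × j ≤ length xs × f i ≡ f j
pigeonhole-∈ xs f f∈
  with i , j , i<j , eq ← Fin.pigeonhole (n<1+n (length xs)) (λ i → index (f∈ (toℕ i))) =
  toℕ i , toℕ j , i<j , Fin.toℕ≤pred[n] j ,
  index-injective (setoid _) (f∈ (toℕ i)) (f∈ (toℕ j)) eq

module _ {s : ℕ} where

  words : ℕ → List (Word (Fin s))
  words zero    = [ [] ]
  words (suc k) = [] ∷ cartesianProductWith _∷_ (allFin s) (words k)

  ∈-words : ∀ {k} w → length w ≤ k → w ∈ₗ words k
  ∈-words {zero}  []      _        = here refl
  ∈-words {suc k} []      _        = here refl
  ∈-words {suc k} (a ∷ w) (s≤s le) =
    there (∈-cartesianProductWith⁺ _∷_ (∈-allFin a) (∈-words w le))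

-- An occurrence of N that ends in s lies within m s because |N| ≤ |m|.
splice-occurrence : ∀ {N T e e′ m s s″ : Word A} {y} → length N ≤ length m →
  y ≡ (e ++ m) ++ s″ → y ≡ (e′ ++ m) ++ s →
  Factor N (T ++ (e ++ m) ++ s) → Factor N (T ++ y)
splice-occurrence {N = N} {T} {e} {e′} {m} {s} {s″} {y} N≤m y≡ y≡′ f
  with B , C , eq ← fromFactor f | length s ≤? length C
... | yes s≤C with k , eq₁ , _ ← split-suffix (B ++ N) (T ++ e ++ m)
                    (trans (++-assoc B N C) (trans (sym eq) (sym (++-assoc T (e ++ m) s)))) s≤C =
  toFactor B (k ++ s″) (begin
    T ++ y                      ≡⟨ cong (T ++_) y≡ ⟩
    T ++ (e ++ m) ++ s″         ≡⟨ ++-assoc T (e ++ m) s″ ⟨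
    (T ++ e ++ m) ++ s″         ≡⟨ cong (_++ s″) eq₁ ⟩
    ((B ++ N) ++ k) ++ s″       ≡⟨ ++-assoc (B ++ N) k s″ ⟩
    (B ++ N) ++ k ++ s″         ≡⟨ ++-assoc B N _ ⟩
    B ++ N ++ k ++ s″           ∎)
  where open ≡-Reasoning
... | no s≰C with k , _ , eq₁ ← split-suffix (T ++ e) B
                    (trans (++-assoc T e (m ++ s)) (trans (cong (T ++_) (sym (++-assoc e m s))) eq))
                    (length-++-mono-≤ N m N≤m (<⇒≤ (≰⇒> s≰C))) =
  toFactor (T ++ e′ ++ k) C (begin
    T ++ y                      ≡⟨ cong (T ++_) y≡′ ⟩
    T ++ (e′ ++ m) ++ s         ≡⟨ cong (T ++_) (++-assoc e′ m s) ⟩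
    T ++ e′ ++ m ++ s           ≡⟨ cong (λ t → T ++ e′ ++ t) eq₁ ⟩
    T ++ e′ ++ k ++ N ++ C      ≡⟨ cong (T ++_) (++-assoc e′ k _) ⟨
    T ++ (e′ ++ k) ++ N ++ C    ≡⟨ ++-assoc T (e′ ++ k) _ ⟨
    (T ++ e′ ++ k) ++ N ++ C    ∎)
  where open ≡-Reasoning

module _ {s : ℕ} (𝒜 : DFA (Fin s)) where
  open DFA 𝒜

  δ*-++ : ∀ q x y → δ* q (x ++ y) ≡ (δ* q x >>= λ r → δ* r y)
  δ*-++ q []      y = refl
  δ*-++ q (a ∷ x) y with δ q a
  ... | just r  = δ*-++ r x y
  ... | nothing = refl

  infix 4 _∼_ _∼?_
  -- The right congruence of the automaton; all words without a run from `init` form a single class.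
  -- Being a record, it lets `x` and `y` be recovered from the type.
  record _∼_ (x y : Word (Fin s)) : Set where
    constructor same
    field same-state : δ* init x ≡ δ* init y

  open _∼_

  ∼-reflexive : ∀ {x y} → x ≡ y → x ∼ y
  ∼-reflexive refl = same refl

  ∼-sym : ∀ {x y} → x ∼ y → y ∼ x
  ∼-sym (same eq) = same (sym eq)

  ∼-trans : ∀ {x y z} → x ∼ y → y ∼ z → x ∼ z
  ∼-trans (same eq) (same eq′) = same (trans eq eq′)

  ∼-++ : ∀ {x y} z → x ∼ y → x ++ z ∼ y ++ z
  ∼-++ {x} {y} z (same eq) = same (trans (δ*-++ init x z)
    (trans (cong (_>>= λ r → δ* r z) eq) (sym (δ*-++ init y z))))

  _∼?_ : ∀ x y → Dec (x ∼ y)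
  x ∼? y = map′ same same-state (Maybe.≡-dec Fin._≟_ (δ* init x) (δ* init y))

  accepted-resp-∼ : ∀ {x y} → x ∼ y → accepted x → accepted y
  accepted-resp-∼ (same eq) (f , f∈ , run) = f , f∈ , trans (sym eq) run

  accepted? : ∀ w → Dec (accepted w)
  accepted? w = Fin.any? λ f → (f ∈ₛ? final) ×-dec Maybe.≡-dec Fin._≟_ (δ* init w) (just f)

  run-prefix : ∀ {q r} x y → Run q (x ++ y) r → ∃ λ p → Run q x p
  run-prefix {q} x y run with δ* q x in eq
  ... | just p  = p , refl
  ... | nothing with () ← trans (sym run) (trans (δ*-++ q x y) (cong (_>>= λ r → δ* r y) eq))

  run-++ : ∀ {p q r} x y → Run p x q → Run q y r → Run p (x ++ y) r
  run-++ {p} x y run run′ = trans (δ*-++ p x y) (trans (cong (_>>= λ r → δ* r y) run) run′)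

  -- The flat language of the accepted words `vʲp` with bounded `v` and `p`.

  stateList : List (Maybe State)
  stateList = nothing ∷ map just (allFin states)

  ∈-stateList : ∀ q → q ∈ₗ stateList
  ∈-stateList nothing  = here refl
  ∈-stateList (just q) = there (∈-map⁺ just (∈-allFin q))

  Code : Set
  Code = (Word (Fin s) × Word (Fin s)) × ℕ × ℕ

  codeChain : Code → Chain (Fin s)
  codeChain ((v , p) , i , k) = (v ^ i) ∙ (v ^ k) *∙ last p

  -- The first condition says that reading `v ^ k` after `v ^ i` changes nothing, so every word of
  -- the chain is accepted as soon as its shortest one is. Both conditions are decidable, so the
  -- good codes can be filtered from a finite list.
  Loops : Code → Set
  Loops ((v , p) , i , k) = (v ^ i ∼ v ^ i ++ v ^ k) × accepted (v ^ i ++ p)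

  loops? : ∀ c → Dec (Loops c)
  loops? ((v , p) , i , k) = (v ^ i ∼? (v ^ i ++ v ^ k)) ×-dec accepted? (v ^ i ++ p)

  codes : ℕ → List Code
  codes K = cartesianProduct (cartesianProduct (words K) (words K))
                             (cartesianProduct (upTo (suc (length stateList))) (upTo (suc (length stateList))))

  chains : ℕ → List (Chain (Fin s))
  chains K = map codeChain (filter loops? (codes K))

  PowerTail : ℕ → Language (Fin s)
  PowerTail K w = Any (λ c → w ∈ chain c) (chains K)

  PowerTail-flat : ∀ K → Flat (PowerTail K)
  PowerTail-flat K = chains K , id , id

  loop-∼ : ∀ {x} y n → x ∼ x ++ y → x ∼ x ++ y ^ n
  loop-∼ {x} y zero    loop = ∼-reflexive (sym (++-identityʳ x))
  loop-∼ {x} y (suc n) loop = ∼-trans (loop-∼ y n loop)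
    (∼-trans (∼-++ (y ^ n) loop) (∼-reflexive (++-assoc x y (y ^ n))))

  PowerTail-accepted : ∀ K {w} → w ∈ PowerTail K → accepted w
  PowerTail-accepted K w∈
    with c , c∈ , w∈c ← find w∈
    with ((v , p) , i , k) , _ , refl , loop , acc-w ← ∈-map∘filter⁻ codeChain loops? {xs = codes K} c∈
    with _ , _ , refl , refl , _ , _ , refl , (n , refl) , refl ← w∈c =
    accepted-resp-∼ (∼-trans (∼-++ p (loop-∼ (v ^ k) n loop)) (∼-reflexive (++-assoc (v ^ i) _ p))) acc-w

  -- Among the powers of `v` with exponents up to `S`, two reach the same state, so the states
  -- reached are eventually periodic. The unbounded exponent `j` is thus split into a bounded start
  -- `i` and `n` rounds of a loop of bounded length `k`.
  ∈-PowerTail : ∀ {K} v j p → length v ≤ K → length p ≤ K →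
                accepted (v ^ j ++ p) → (v ^ j ++ p) ∈ PowerTail K
  ∈-PowerTail {K} v j p v≤K p≤K acc-w =
    let i , k , n , i≤ , k≤ , loop , eq = exponents in
    lose (∈-map∘filter⁺ codeChain loops?
           (_ , ∈-cartesianProduct⁺ (∈-cartesianProduct⁺ (∈-words v v≤K) (∈-words p p≤K))
                                    (∈-cartesianProduct⁺ (∈-upTo⁺ (s≤s i≤)) (∈-upTo⁺ (s≤s k≤)))
            , refl , loop ,
            accepted-resp-∼ (∼-++ p (∼-trans (∼-reflexive eq) (∼-sym (loop-∼ (v ^ k) n loop)))) acc-w))
         (v ^ i , (v ^ k) ^ n ++ p , trans (cong (_++ p) eq) (++-assoc (v ^ i) _ p) , refl ,
          (v ^ k) ^ n , p , refl , (n , refl) , refl)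
    where
    S = length stateList

    exponents : ∃₂ λ i k → ∃ λ n → i ≤ S × k ≤ S × (v ^ i ∼ v ^ i ++ v ^ k) × v ^ j ≡ v ^ i ++ (v ^ k) ^ n
    exponents with pigeonhole-∈ stateList (λ i → δ* init (v ^ i)) (λ i → ∈-stateList _)
    ... | i , i′ , i<i′ , i′≤S , eq with i ≤? j
    -- Before the cycle begins, `j` is itself bounded, and the degenerate loop with `k = 0` serves.
    ...   | no i≰j = j , 0 , 0 , ≤-trans (<⇒≤ (≰⇒> i≰j)) (≤-trans (<⇒≤ i<i′) i′≤S) , z≤n ,
                     ∼-reflexive (sym (++-identityʳ (v ^ j))) , sym (++-identityʳ (v ^ j))
    -- Delaying the loop by the remainder `ρ` leaves a multiple of `k`, and the start `i + ρ` is
    -- still below `i′`.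
    ...   | yes i≤j = i + ρ , k , n , ≤-trans (<⇒≤ i+ρ<i′) i′≤S , ≤-trans (m∸n≤m i′ i) i′≤S , loop , power
      where
      k = i′ ∸ i
      i+k≡i′ : i + k ≡ i′
      i+k≡i′ = m+[n∸m]≡n (<⇒≤ i<i′)
      instance
        k≢0 : NonZero k
        k≢0 = >-nonZero (m<n⇒0<n∸m i<i′)
      ρ = (j ∸ i) % k
      n = (j ∸ i) / k
      i+ρ<i′ : i + ρ < i′
      i+ρ<i′ = subst (i + ρ <_) i+k≡i′ (+-monoʳ-< i (m%n<n (j ∸ i) k))
      loop : v ^ (i + ρ) ∼ v ^ (i + ρ) ++ v ^ k
      loop = same (begin
        δ* init (v ^ (i + ρ))            ≡⟨ cong (δ* init) (^-+ v i ρ) ⟩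
        δ* init (v ^ i ++ v ^ ρ)         ≡⟨ same-state (∼-++ {v ^ i} {v ^ i′} (v ^ ρ) (same eq)) ⟩
        δ* init (v ^ i′ ++ v ^ ρ)        ≡⟨ cong (δ* init) (^-+ v i′ ρ) ⟨
        δ* init (v ^ (i′ + ρ))           ≡⟨ cong (λ m → δ* init (v ^ (m + ρ))) i+k≡i′ ⟨
        δ* init (v ^ (i + k + ρ))        ≡⟨ cong (λ m → δ* init (v ^ m)) (trans (+-assoc i k ρ) (trans (cong (i +_) (+-comm k ρ)) (sym (+-assoc i ρ k)))) ⟩
        δ* init (v ^ (i + ρ + k))        ≡⟨ cong (δ* init) (^-+ v (i + ρ) k) ⟩
        δ* init (v ^ (i + ρ) ++ v ^ k)   ∎)
        where open ≡-Reasoning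
      power : v ^ j ≡ v ^ (i + ρ) ++ (v ^ k) ^ n
      power = begin
        v ^ j                          ≡⟨ cong (v ^_) (m+[n∸m]≡n i≤j) ⟨
        v ^ (i + (j ∸ i))              ≡⟨ cong (λ m → v ^ (i + m)) (m≡m%n+[m/n]*n (j ∸ i) k) ⟩
        v ^ (i + (ρ + n * k))          ≡⟨ cong (v ^_) (+-assoc i ρ _) ⟨
        v ^ (i + ρ + n * k)            ≡⟨ ^-+ v (i + ρ) (n * k) ⟩
        v ^ (i + ρ) ++ v ^ (n * k)     ≡⟨ cong (v ^ (i + ρ) ++_) (^-* v k n) ⟩
        v ^ (i + ρ) ++ (v ^ k) ^ n     ∎
        where open ≡-Reasoning

  -- Replacing an accepted word by some `vʲp` without creating occurrences of the needle.

  -- The left contexts T stand for the haystack up to an occurrence of z.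
  record Replaceable (K : ℕ) (N y : Word (Fin s)) : Set where
    field
      v p        : Word (Fin s)
      j          : ℕ
      v≤K        : length v ≤ K
      p≤K        : length p ≤ K
      isAccepted : accepted (v ^ j ++ p)
      occurrence : ∀ T → Factor N (T ++ v ^ j ++ p) → Factor N (T ++ y)

  open Replaceable

  Replaceable-mono : ∀ {K K′ N y} → K ≤ K′ → Replaceable K N y → Replaceable K′ N y
  Replaceable-mono K≤K′ r = record
    { v = v r ; p = p r ; j = j r
    ; v≤K = ≤-trans (v≤K r) K≤K′ ; p≤K = ≤-trans (p≤K r) K≤K′
    ; isAccepted = isAccepted r ; occurrence = occurrence r }

  Replaceable-trans : ∀ {K N w y} → (∀ T → Factor N (T ++ w) → Factor N (T ++ y)) →
                      Replaceable K N w → Replaceable K N y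
  Replaceable-trans w⇒y r = record
    { v = v r ; p = p r ; j = j r ; v≤K = v≤K r ; p≤K = p≤K r
    ; isAccepted = isAccepted r ; occurrence = λ T → w⇒y T ∘ occurrence r T }

  itself : ∀ {K N y} v j p → y ≡ v ^ j ++ p → length v ≤ K → length p ≤ K →
           accepted y → Replaceable K N y
  itself v j p refl v≤K p≤K acc-y = record
    { v = v ; p = p ; j = j ; v≤K = v≤K ; p≤K = p≤K ; isAccepted = acc-y ; occurrence = λ T → id }

  -- Strong induction on the length of `y`: each cut keeps acceptance, shortens `y` and creates no
  -- occurrence. At length at most `K` the word is its own tail `p`, with `v` empty.
  replaceable-bounded : ∀ c → ∃ λ K → ∀ N y → length N ≤ c → accepted y → Replaceable K N y
  replaceable-bounded c = K , λ N y N≤c → go N N≤c y (<-wellFounded (length y))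
    where
    keys : List (Maybe State × Word (Fin s))
    keys = cartesianProduct stateList (words c)
    K = c + length keys

    go : ∀ N → length N ≤ c → ∀ y → Acc _<_ (length y) → accepted y → Replaceable K N y
    go N N≤c y (acc rec) acc-y with length y ≤? K
    ... | yes y≤K = itself [] 0 y refl z≤n y≤K acc-y
    ... | no  y≰K = Replaceable-trans splice (go N N≤c w (rec w<y) acc-w)
      where
      -- The state after the prefix of length `c + i`, and the last `c` letters of that prefix. The
      -- truncation for large `i` is harmless: the repetition is found among `i ≤ length keys`,
      -- where `c + i ≤ K < length y`.
      key : ℕ → Maybe State × Word (Fin s)
      key i = δ* init (take (c + i) y) , drop i (take (c + i) y)

      window≤ : ∀ i → length (drop i (take (c + i) y)) ≤ c
      window≤ i = begin
        length (drop i (take (c + i) y))  ≡⟨ length-drop i (take (c + i) y) ⟩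
        length (take (c + i) y) ∸ i       ≡⟨ cong (_∸ i) (length-take (c + i) y) ⟩
        (c + i) ⊓ length y ∸ i            ≤⟨ ∸-monoˡ-≤ i (m⊓n≤m (c + i) _) ⟩
        c + i ∸ i                         ≡⟨ m+n∸n≡m c i ⟩
        c                                 ∎
        where open ≤-Reasoning

      found = pigeonhole-∈ keys key λ i → ∈-cartesianProduct⁺ (∈-stateList _) (∈-words _ (window≤ i))
      i  = proj₁ found
      i′ = proj₁ (proj₂ found)
      i<i′ = proj₁ (proj₂ (proj₂ found))
      i′≤ = proj₁ (proj₂ (proj₂ (proj₂ found)))
      repeated = proj₂ (proj₂ (proj₂ (proj₂ found)))
      m  = drop i (take (c + i) y)
      e  = take i (take (c + i) y)
      e′ = take i′ (take (c + i′) y)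

      in-range : ∀ {i} → i ≤ i′ → c + i ≤ length y
      in-range i≤ = ≤-trans (+-monoʳ-≤ c (≤-trans i≤ i′≤)) (<⇒≤ (≰⇒> y≰K))

      length-prefix : ∀ {i} → i ≤ i′ → length (take (c + i) y) ≡ c + i
      length-prefix {i} i≤ = trans (length-take (c + i) y) (m≤n⇒m⊓n≡m (in-range i≤))

      y≡ : y ≡ (e ++ m) ++ drop (c + i) y
      y≡ = sym (trans (cong (_++ drop (c + i) y) (take++drop≡id i (take (c + i) y))) (take++drop≡id (c + i) y))

      y≡′ : y ≡ (e′ ++ m) ++ drop (c + i′) y
      y≡′ = sym (trans (cong (_++ drop (c + i′) y)
              (trans (cong (e′ ++_) (cong proj₂ repeated)) (take++drop≡id i′ (take (c + i′) y))))
              (take++drop≡id (c + i′) y))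

      N≤m : length N ≤ length m
      N≤m = ≤-trans N≤c (≤-reflexive (sym (trans (length-drop i (take (c + i) y))
              (trans (cong (_∸ i) (length-prefix (<⇒≤ i<i′))) (m+n∸n≡m c i)))))

      w = take (c + i) y ++ drop (c + i′) y

      w<y : length w < length y
      w<y = begin-strict
        length w                                            ≡⟨ length-++ (take (c + i) y) ⟩
        length (take (c + i) y) + length (drop (c + i′) y)  ≡⟨ cong (_+ length (drop (c + i′) y)) (length-prefix (<⇒≤ i<i′)) ⟩
        c + i + length (drop (c + i′) y)                    <⟨ +-monoˡ-< _ (+-monoʳ-< c i<i′) ⟩
        c + i′ + length (drop (c + i′) y)                   ≡⟨ cong (_+ length (drop (c + i′) y)) (length-prefix ≤-refl) ⟨
        length (take (c + i′) y) + length (drop (c + i′) y) ≡⟨ length-++ (take (c + i′) y) ⟨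
        length (take (c + i′) y ++ drop (c + i′) y)         ≡⟨ cong length (take++drop≡id (c + i′) y) ⟩
        length y                                            ∎
        where open ≤-Reasoning

      acc-w : accepted w
      acc-w = accepted-resp-∼ (∼-trans (∼-reflexive (sym (take++drop≡id (c + i′) y)))
                                     (∼-++ {y = take (c + i) y} (drop (c + i′) y) (same (sym (cong proj₁ repeated))))) acc-y

      splice : ∀ T → Factor N (T ++ w) → Factor N (T ++ y)
      splice T = splice-occurrence {T = T} {e′ = e′} N≤m y≡ y≡′
               ∘ subst (λ t → Factor N (T ++ t ++ drop (c + i′) y)) (sym (take++drop≡id i (take (c + i) y)))

  module _ (R : ℕ) (toFinal : ∀ q → ∃ λ r → length r ≤ R × ∃ λ f → f ∈ₛ final × Run q r f) where

    -- Take for `v` the first `d` letters of `y`; then the `d`-periodic prefix of `y` lasts as long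
    -- as the rest follows the powers of `v`. If it never breaks, or at most `c` letters follow the
    -- break, `y` already has the required form. The constant `d + suc (c + R)` bounds the new tail,
    -- made of less than a period, the breaking letter, `c` letters and the path `r`. It is also the
    -- length that forces `X` to cover the mismatch.
    replaceable-long : ∀ {d c} N′ X ℓ y → d > 0 → Periodic d X → length ℓ ≤ c →
      d + suc (c + R) ≤ length X → accepted y → Replaceable (d + suc (c + R)) (N′ ++ X ++ ℓ) y
    replaceable-long {d} {c} N′ X ℓ y d>0 perX ℓ≤c X≥ acc-y with d ≤? length y
    ... | no d≰y = itself [] 0 y refl z≤n (≤-trans (<⇒≤ (≰⇒> d≰y)) (m≤m+n _ _)) acc-y
    ... | yes d≤y with prefix-of-length d y d≤y
    ... | v , y₁ , refl , refl with strip-powers Fin._≟_ v y₁ d>0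
    ... | short j p refl p≤v =
      itself v (suc j) p (sym (++-assoc v _ p)) (m≤m+n _ _) (≤-trans p≤v (m≤m+n _ _)) acc-y
    ... | broken j v₁ b v₂ a p v≡ refl b≢a with length p ≤? c
    ...   | yes p≤c = itself v (suc j) (v₁ ++ a ∷ p) (sym (++-assoc v _ _)) (m≤m+n _ _) (begin
        length (v₁ ++ a ∷ p)        ≡⟨ length-++ v₁ ⟩
        length v₁ + suc (length p)  ≤⟨ +-mono-≤ (≤-trans (m≤m+n _ _) (≤-reflexive (trans (sym (length-++ v₁)) (cong length (sym v≡)))))
                                                (s≤s (≤-trans p≤c (m≤m+n c R))) ⟩
        d + suc (c + R)             ∎) acc-y
      where open ≤-Reasoning
    ...   | no p≰c with prefix-of-length c p (<⇒≤ (≰⇒> p≰c))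
    ...     | p₁ , p₂ , refl , refl = record
        { v = v ; j = suc j ; p = v₁ ++ a ∷ p₁ ++ r
        ; v≤K = m≤m+n _ _
        ; p≤K = (begin
            length (v₁ ++ a ∷ p₁ ++ r)  ≡⟨ length-++ v₁ ⟩
            length v₁ + suc (length (p₁ ++ r))  ≡⟨ cong (λ t → length v₁ + suc t) (length-++ p₁) ⟩
            length v₁ + suc (length p₁ + length r)  ≤⟨ +-mono-≤ (≤-trans (m≤m+n _ _) (≤-reflexive (trans (sym (length-++ v₁)) (cong length (sym v≡)))))
                                                (s≤s (+-monoʳ-≤ (length p₁) r≤R)) ⟩
            d + suc (c + R)             ∎)
        ; isAccepted = subst accepted qr≡ (f , f∈ , run-++ q r run-q run-r)
        ; occurrence = λ T → subst (λ t → Factor N (T ++ t)) (sym y≡) ∘ extend T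
                     ∘ occurrence-before-tail T u₁ b u₂ a p₁ r N′ X ℓ b≢a u₂-length perX ℓ≤c
                         (≤-trans (+-monoʳ-≤ d (s≤s (+-monoʳ-≤ c r≤R))) X≥)
                     ∘ subst (λ t → Factor N (T ++ t)) (sym qr≡)
        }
      where
      N = N′ ++ X ++ ℓ
      -- Rebracketing of `v ^ suc j ++ v₁ ++ a ∷ p₁` that exposes the letter `b` lying `d` places
      -- before `a`, inside the last copy of `v`.
      u₁ = v ^ j ++ v₁
      u₂ = v₂ ++ v₁
      q = u₁ ++ b ∷ u₂ ++ a ∷ p₁

      q≡ : q ≡ v ^ suc j ++ v₁ ++ a ∷ p₁
      q≡ = begin
        (v ^ j ++ v₁) ++ b ∷ (v₂ ++ v₁) ++ a ∷ p₁   ≡⟨ ++-assoc (v ^ j) v₁ _ ⟩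
        v ^ j ++ v₁ ++ b ∷ (v₂ ++ v₁) ++ a ∷ p₁     ≡⟨ cong (λ t → v ^ j ++ v₁ ++ b ∷ t) (++-assoc v₂ v₁ _) ⟩
        v ^ j ++ v₁ ++ b ∷ v₂ ++ v₁ ++ a ∷ p₁       ≡⟨ cong (v ^ j ++_) (++-assoc v₁ (b ∷ v₂) _) ⟨
        v ^ j ++ (v₁ ++ b ∷ v₂) ++ v₁ ++ a ∷ p₁     ≡⟨ cong (λ t → v ^ j ++ t ++ v₁ ++ a ∷ p₁) v≡ ⟨
        v ^ j ++ v ++ v₁ ++ a ∷ p₁                  ≡⟨ ++-assoc (v ^ j) v _ ⟨
        (v ^ j ++ v) ++ v₁ ++ a ∷ p₁                ≡⟨ cong (_++ v₁ ++ a ∷ p₁) (^-comm v j) ⟨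
        v ^ suc j ++ v₁ ++ a ∷ p₁                   ∎
        where open ≡-Reasoning

      q-++ : ∀ t → q ++ t ≡ v ^ suc j ++ v₁ ++ a ∷ p₁ ++ t
      q-++ t = trans (cong (_++ t) q≡) (trans (++-assoc (v ^ suc j) _ t) (cong (v ^ suc j ++_) (++-assoc v₁ _ t)))

      y≡ : v ++ v ^ j ++ v₁ ++ a ∷ p₁ ++ p₂ ≡ q ++ p₂
      y≡ = trans (sym (++-assoc v _ _)) (sym (q-++ p₂))

      run-to = run-prefix q p₂ (subst (λ t → Run init t _) y≡ (proj₂ (proj₂ acc-y)))
      run-q = proj₂ run-to
      exit = toFinal (proj₁ run-to)
      r = proj₁ exit
      r≤R = proj₁ (proj₂ exit)
      f = proj₁ (proj₂ (proj₂ exit))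
      f∈ = proj₁ (proj₂ (proj₂ (proj₂ exit)))
      run-r = proj₂ (proj₂ (proj₂ (proj₂ exit)))

      qr≡ : q ++ r ≡ v ^ suc j ++ v₁ ++ a ∷ p₁ ++ r
      qr≡ = q-++ r

      u₂-length : length (b ∷ u₂) ≡ length v
      u₂-length = begin
        length ((b ∷ v₂) ++ v₁)        ≡⟨ length-++ (b ∷ v₂) ⟩
        length (b ∷ v₂) + length v₁    ≡⟨ +-comm (length (b ∷ v₂)) _ ⟩
        length v₁ + length (b ∷ v₂)    ≡⟨ length-++ v₁ ⟨
        length (v₁ ++ b ∷ v₂)          ≡⟨ cong length v≡ ⟨
        length v                       ∎
        where open ≡-Reasoning

      extend : ∀ T → Factor N (T ++ q) → Factor N (T ++ q ++ p₂)
      extend T = subst (Factor N) (++-assoc T q p₂) ∘ (Infix._ⁱ++ p₂)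

      open ≤-Reasoning

    -- `ℓ` holds the value of the part of the needle already stripped, hence the arbitrary `c`. As
    -- `K` is chosen before `σ`, the periods have to be the same for all assignments in `M`.
    replaceable : ∀ {n} {t : Term (Fin s) n} → Reverse t → (M : Assignment (Fin s) n → Set) →
      (∀ x → x ∈ₗ vars t → ∃ λ d → d > 0 × ∀ σ → M σ → Periodic d (σ x)) →
      ∀ c → ∃ λ K → ∀ σ ℓ y → M σ → length ℓ ≤ c → accepted y → Replaceable K (σ ⟨ t ⟩ ++ ℓ) y
    replaceable [] M per c with K , rep ← replaceable-bounded c = K , λ σ ℓ y _ → rep ℓ y
    replaceable (t ∶ rs ∶ʳ inj₂ a) M per c
      with K , rep ← replaceable rs M (λ x x∈ → per x (subst (x ∈ₗ_) (sym (mapMaybe-++ _ t _)) (∈-++⁺ˡ x∈))) (suc c) =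
      K , λ σ ℓ y mσ ℓ≤c acc-y → subst (λ N → Replaceable K N y)
            (sym (trans (cong (_++ ℓ) (concatMap-++ _ t _)) (++-assoc (σ ⟨ t ⟩) [ a ] ℓ)))
            (rep σ (a ∷ ℓ) y mσ (s≤s ℓ≤c) acc-y)
    replaceable (t ∶ rs ∶ʳ inj₁ x) M per c
      with d , d>0 , per-x ← per x (subst (x ∈ₗ_) (sym (mapMaybe-++ _ t _)) (∈-++⁺ʳ (vars t) (here refl)))
      with K , rep ← replaceable rs M (λ x x∈ → per x (subst (x ∈ₗ_) (sym (mapMaybe-++ _ t _)) (∈-++⁺ˡ x∈)))
                       (d + suc (c + R) + c) =
      -- Whether `σ x` is long depends on `σ`, so the bound has to cover both cases. A short `σ x`
      -- joins `ℓ`, which explains the enlarged bound in the recursive call.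
      K + (d + suc (c + R)) , λ σ ℓ y mσ ℓ≤c acc-y → subst (λ N → Replaceable _ N y)
            (sym (trans (cong (_++ ℓ) (trans (concatMap-++ _ t _) (cong (σ ⟨ t ⟩ ++_) (++-identityʳ (σ x)))))
                        (++-assoc (σ ⟨ t ⟩) (σ x) ℓ)))
            (step σ ℓ y mσ ℓ≤c acc-y)
      where
      step : ∀ σ ℓ y → M σ → length ℓ ≤ c → accepted y →
             Replaceable (K + (d + suc (c + R))) (σ ⟨ t ⟩ ++ σ x ++ ℓ) y
      step σ ℓ y mσ ℓ≤c acc-y with d + suc (c + R) ≤? length (σ x)
      ... | yes long = Replaceable-mono (m≤n+m _ K)
                         (replaceable-long (σ ⟨ t ⟩) (σ x) ℓ y d>0 (per-x σ mσ) ℓ≤c long acc-y)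
      ... | no ¬long = Replaceable-mono (m≤m+n K _) (rep σ (σ x ++ ℓ) y mσ
                         (≤-trans (≤-reflexive (length-++ (σ x))) (+-mono-≤ (<⇒≤ (≰⇒> ¬long)) ℓ≤c)) acc-y)

-- Marked terms and instantiated constraints

private
  variable
    n : ℕ

prefix-unmark : ∀ (N l : Word A) {r} → Prefix _≡_ (map just N) (map just l ++ nothing ∷ r) → Prefix _≡_ N l
prefix-unmark []      l       _            = []
prefix-unmark (b ∷ N) []      (() ∷ _)
prefix-unmark (b ∷ N) (a ∷ l) (refl ∷ pre) = refl ∷ prefix-unmark N l pre

-- No letter of `map just N` is `nothing`, so an occurrence lies entirely on one side of the
-- separator.
factor-marked : ∀ (N l : Word A) {r} → Factor (map just N) (map just l ++ nothing ∷ r) →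
                Factor N l ⊎ Factor (map just N) r
factor-marked []      l       f                  = inj₁ (Infix.here [])
factor-marked (b ∷ N) []      (Infix.here (() ∷ _))
factor-marked N       []      (Infix.there f)    = inj₂ f
factor-marked N       (a ∷ l) (Infix.here pre)   = inj₁ (Infix.here (prefix-unmark N (a ∷ l) pre))
factor-marked N       (a ∷ l) (Infix.there f)    = map-⊎ Infix.there id (factor-marked N l f)

factor-unmap : ∀ (N l : Word A) → Factor (map just N) (map just l) → Factor N l
factor-unmap N l = Infix.map Maybe.just-injective ∘ Infix.map⁻ just just

-- The local substitution of `φ [ z / z #]` made available to lemmas; `markTerm z` agrees by
-- unfolding with the marking of the two terms there.
mark : Fin n → Fin n → Term (Maybe A) n
mark z x = if does (x Fin.≟ z) then inj₁ z ∷ inj₂ nothing ∷ [] else [ inj₁ x ]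

markTerm : Fin n → Term A n → Term (Maybe A) n
markTerm z t = replace (mark z) (map (map₂ just) t)

module _ (σ : Assignment A n) (z : Fin n) (w : Word A) where

  τ : Assignment (Maybe A) n
  τ = embed (σ ◁ z ↦ w)

  value-at : ∀ t → τ ⟨ markTerm z (inj₁ z ∷ t) ⟩ ≡ map just w ++ nothing ∷ τ ⟨ markTerm z t ⟩
  value-at t = trans (concatMap-++ _ (mark z z) (markTerm z t))
                     (trans (cong (_++ τ ⟨ markTerm z t ⟩) value) (++-assoc (map just w) _ _))
    where
    value : τ ⟨ mark z z ⟩ ≡ map just w ++ [ nothing ]
    value with z Fin.≟ z in eq
    ... | yes _  rewrite eq = refl
    ... | no z≢z = contradiction refl z≢z

  value-off : ∀ {x} → x ≢ z → ∀ t → τ ⟨ markTerm z (inj₁ x ∷ t) ⟩ ≡ map just (σ x) ++ τ ⟨ markTerm z t ⟩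
  value-off {x} x≢z t = trans (concatMap-++ _ (mark z x) (markTerm z t)) (cong (_++ τ ⟨ markTerm z t ⟩) value)
    where
    value : τ ⟨ mark z x ⟩ ≡ map just (σ x)
    value with x Fin.≟ z in eq
    ... | yes x≡z = contradiction x≡z x≢z
    ... | no  _  rewrite eq = ++-identityʳ _

  mark-needle : ∀ t → z ∉ₗ vars t → τ ⟨ markTerm z t ⟩ ≡ map just (σ ⟨ t ⟩)
  mark-needle []           z∉ = refl
  mark-needle (inj₂ a ∷ t) z∉ = cong (just a ∷_) (mark-needle t z∉)
  mark-needle (inj₁ x ∷ t) z∉ = trans (value-off (λ x≡z → z∉ (here (sym x≡z))) t)
    (trans (cong (map just (σ x) ++_) (mark-needle t (z∉ ∘ there))) (sym (map-++ just (σ x) _)))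

  -- T is the value of the part of the haystack behind the last #: no occurrence
  -- of N crosses a #.
  mark-haystack : ∀ {N} → (∀ T → Factor N (T ++ w) → Factor N (T ++ σ z)) →
                  ∀ t T → Factor (map just N) (map just T ++ τ ⟨ markTerm z t ⟩) → Factor N (T ++ σ ⟨ t ⟩)
  mark-haystack {N} w⇒z [] T f =
    subst (Factor N) (sym (++-identityʳ T)) (factor-unmap N T (subst (Factor _) (++-identityʳ _) f))
  mark-haystack {N} w⇒z (inj₂ a ∷ t) T f =
    subst (Factor N) (++-assoc T [ a ] _) (mark-haystack w⇒z t (T ++ [ a ])
      (subst (Factor _) (sym (trans (cong (_++ _) (map-++ just T [ a ])) (++-assoc (map just T) _ _))) f))
  mark-haystack {N} w⇒z (inj₁ x ∷ t) T f = by-cases (x Fin.≟ z)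
    where
    open ≡-Reasoning
    rest = τ ⟨ markTerm z t ⟩

    by-cases : Dec (x ≡ z) → Factor N (T ++ σ x ++ σ ⟨ t ⟩)
    by-cases (no x≢z) =
      subst (Factor N) (++-assoc T (σ x) _) (mark-haystack w⇒z t (T ++ σ x) (subst (Factor _) (begin
        map just T ++ τ ⟨ markTerm z (inj₁ x ∷ t) ⟩  ≡⟨ cong (map just T ++_) (value-off x≢z t) ⟩
        map just T ++ map just (σ x) ++ rest         ≡⟨ ++-assoc (map just T) _ _ ⟨
        (map just T ++ map just (σ x)) ++ rest       ≡⟨ cong (_++ rest) (map-++ just T (σ x)) ⟨
        map just (T ++ σ x) ++ rest                  ∎) f))
    by-cases (yes refl) with factor-marked N (T ++ w) (subst (Factor _) marked f)
      where
      marked : map just T ++ τ ⟨ markTerm z (inj₁ z ∷ t) ⟩ ≡ map just (T ++ w) ++ nothing ∷ rest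
      marked = begin
        map just T ++ τ ⟨ markTerm z (inj₁ z ∷ t) ⟩   ≡⟨ cong (map just T ++_) (value-at t) ⟩
        map just T ++ map just w ++ nothing ∷ rest    ≡⟨ ++-assoc (map just T) _ _ ⟨
        (map just T ++ map just w) ++ nothing ∷ rest  ≡⟨ cong (_++ nothing ∷ rest) (map-++ just T w) ⟨
        map just (T ++ w) ++ nothing ∷ rest           ∎
    ... | inj₁ left  = subst (Factor N) (++-assoc T (σ z) _) (w⇒z T left Infix.ⁱ++ σ ⟨ t ⟩)
    ... | inj₂ right = T Infix.++ⁱ σ z Infix.++ⁱ mark-haystack w⇒z t [] right

vars-literal : ∀ (w : Word A) → vars {n = n} (literal w) ≡ []
vars-literal []      = refl
vars-literal (a ∷ w) = vars-literal w

vars-replace : ∀ {ρ : Fin n → Term A n} → (∀ {x y} → y ∈ₗ vars (ρ x) → y ≡ x) →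
               ∀ t {x} → x ∈ₗ vars (replace ρ t) → x ∈ₗ vars t
vars-replace ρ-vars (inj₂ a ∷ t) x∈ = vars-replace ρ-vars t x∈
vars-replace {ρ = ρ} ρ-vars (inj₁ y ∷ t) {x} x∈
  with ∈-++⁻ (vars (ρ y)) (subst (x ∈ₗ_) (mapMaybe-++ _ (ρ y) _) x∈)
... | inj₁ x∈ρ = here (ρ-vars x∈ρ)
... | inj₂ x∈t = there (vars-replace ρ-vars t x∈t)

module _ (ψ : Constraint A n) (ℓ : ℕ) (η : Assignment A n) where
  open Constraint
  open DecMembership (Fin._≟_ {n}) using (_∈?_)

  vars-needle-instantiate : ∀ {x} → x ∈ₗ vars (needle (instantiate ψ ℓ η)) → x ∈ₗ vars (needle ψ)
  vars-needle-instantiate = vars-replace ρ-vars (needle ψ)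
    where
    ρ-vars : ∀ {x y} → y ∈ₗ vars (if does (x ∈? vars (needle ψ) ×-dec length (η x) <? ℓ)
                                    then literal (η x) else [ inj₁ x ]) → y ≡ x
    ρ-vars {x} y∈ with does (x ∈? vars (needle ψ) ×-dec length (η x) <? ℓ)
    ρ-vars {x} {y} y∈ | true with () ← subst (y ∈ₗ_) (vars-literal (η x)) y∈
    ρ-vars (here eq) | false = eq

  lang-instantiate-⊆ : ∀ x → lang (instantiate ψ ℓ η) x ⊆ lang ψ x
  lang-instantiate-⊆ x w∈ with does (x ∈? vars (needle ψ) ×-dec ℓ ≤? length (η x))
  ... | true  = proj₁ w∈
  ... | false = w∈

  -- Length restrictions fall only on needle variables. The non-flat `z` is not one of them, so its
  -- new value may be short.
  lang-instantiate-∉ : ∀ {x} → x ∉ₗ vars (needle ψ) → lang ψ x ⊆ lang (instantiate ψ ℓ η) x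
  lang-instantiate-∉ {x} x∉ w∈ with x ∈? vars (needle ψ)
  ... | yes x∈ = contradiction x∈ x∉
  ... | no  _  = w∈

-- Periods of flat variables and paths to the final state.

^-nonempty : ∀ {w : Word A} {k} → length w > 0 → k ≥ 1 → length (w ^ k) > 0
^-nonempty {w = _ ∷ _} {suc k} _ _ = s≤s z≤n

primitive-nonempty : ∀ {α : Word A} → Primitive α → length α > 0
primitive-nonempty {α = []}    prim = contradiction ([] , 2 , s≤s (s≤s z≤n) , refl) prim
primitive-nonempty {α = _ ∷ _} _    = s≤s z≤n

-- The length of `α ^ k` serves all words of `L` at once; it is positive because the empty word is
-- its own square and so not primitive.
base-period : ∀ {L : Language A} → ∃ (HasBase L) → ∃ λ d → d > 0 × (∀ {w} → w ∈ L → Periodic d w)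
base-period {L = L} (α , prim , k , k≥1 , L⊆ , _) =
  length (α ^ k) , ^-nonempty (primitive-nonempty prim) k≥1 , periodic
  where
  periodic : ∀ {w} → w ∈ L → Periodic (length (α ^ k)) w
  periodic w∈ with i , eq ← L⊆ w∈ = subst (Periodic _) (sym eq) (^-periodic (α ^ k) i)

module _ {s} {L : Language (Fin s)} (𝒜 : DFA (Fin s)) (dec : DecomposedBy 𝒜 L) where
  open DFA 𝒜
  open DecomposedBy dec

  -- All states lie in the component of one state `p`, so a path can go from `q` to `p` and on to
  -- the final state.
  pathToFinal : ∀ q → ∃ λ r → ∃ λ f → f ∈ₛ final × Run q r f
  pathToFinal q with f , final≡ ← singleFinal | p , _ , all-SCC ← singleSCC
    with _ , x , run-x ← proj₁ (all-SCC q) {q} (([] , refl) , ([] , refl))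
       | (y , run-y) , _ ← proj₁ (all-SCC f) {f} (([] , refl) , ([] , refl)) =
    x ++ y , f , subst (f ∈ₛ_) (sym final≡) (x∈⁅x⁆ f) , run-++ 𝒜 x y run-x run-y

  path-bound : ℕ
  path-bound = max 0 (map (length ∘ proj₁ ∘ pathToFinal) (allFin states))

  boundedPathToFinal : ∀ q → ∃ λ r → length r ≤ path-bound × ∃ λ f → f ∈ₛ final × Run q r f
  boundedPathToFinal q with r , f ← pathToFinal q in eq =
    r , subst (λ p → length (proj₁ p) ≤ path-bound) eq
          (All.lookup (xs≤max 0 (map (length ∘ proj₁ ∘ pathToFinal) (allFin states))) (∈-map⁺ _ (∈-allFin q))) , f

theorem22 : (s n : ℕ) (ψ : Constraint (Fin s) n) (𝒜 : Fin n → DFA (Fin s)) →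
    Normalized ψ 𝒜 →
    (∀ x → x ∈ₗ vars (Constraint.needle ψ) → Flat (Constraint.lang ψ x)) →
    (γ : Fin n → Word (Fin s)) → GammaChoice ψ 𝒜 γ →
    (B : Bounds ψ 𝒜 γ) (η : Assignment (Fin s) n) →
    let φ = instantiate ψ (Bounds.λ-Flat B) η in
    (∃[ x ] x ∈ₗ vars (Constraint.needle φ)) →
    (z : Fin n) → z ∈ₗ vars (Constraint.haystack φ) → ¬ Flat (Constraint.lang ψ z) →
    Σ[ L ∈ Language (Fin s) ]
    Flat L × L ⊂ Constraint.lang ψ z ×
    (∀ σ → σ ⊨ φ →
    ∃[ w ] w ∈ L × embed (σ ◁ z ↦ w) ⊨ φ [ z / z #])
theorem22 s n ψ 𝒜 norm flat γ _ B η _ z _ ¬flat =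
  L , L-flat , (L⊆ , λ ⊆L → ¬flat (flat-if-⊇ ⊆L)) , transfer
  where
  open Constraint
  open Normalized norm
  open Replaceable
  open DecomposedBy (decomposed z) using (recognises)

  ℓ = Bounds.λ-Flat B
  φ = instantiate ψ ℓ η

  -- Variables left in the needle were in the original needle, hence are flat, and their languages
  -- only shrink under instantiation, so the period persists.
  period : ∀ x → x ∈ₗ vars (needle φ) → ∃ λ d → d > 0 × ∀ σ → σ ⊨ φ → Periodic d (σ x)
  period x x∈ with d , d>0 , per ← base-period (flatForm x (flat x (vars-needle-instantiate ψ ℓ η x∈))) =
    d , d>0 , λ σ σ⊨φ → per (lang-instantiate-⊆ ψ ℓ η x (proj₁ σ⊨φ x))

  -- Nothing is stripped at the start, so `ℓ` is empty and `c = 0`.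
  bound = replaceable (𝒜 z) (path-bound (𝒜 z) (decomposed z)) (boundedPathToFinal (𝒜 z) (decomposed z))
            (reverseView (needle φ)) (_⊨ φ) period 0
  K = proj₁ bound

  L : Language (Fin s)
  L = PowerTail (𝒜 z) K

  L-flat : Flat L
  L-flat = PowerTail-flat (𝒜 z) K

  L⊆ : L ⊆ lang ψ z
  L⊆ w∈ = proj₂ recognises (PowerTail-accepted (𝒜 z) K w∈)

  -- Gives strictness of the inclusion: equality would make `z` flat.
  flat-if-⊇ : lang ψ z ⊆ L → Flat (lang ψ z)
  flat-if-⊇ ⊆L = proj₁ L-flat , ⊆L , L⊆

  z∉ψ : z ∉ₗ vars (needle ψ)
  z∉ψ = ¬flat ∘ flat z

  transfer : ∀ σ → σ ⊨ φ → ∃[ w ] w ∈ L × embed (σ ◁ z ↦ w) ⊨ φ [ z / z #]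
  -- Since `z` is absent from the needle, marking leaves the needle's value unchanged. An occurrence
  -- in the marked haystack would then give one in the original haystack under `σ`.
  transfer σ σ⊨φ@(σ∈ , ¬contains) = w , w∈L , in-lang , λ f →
    ¬contains (mark-haystack σ z w w⇒z (haystack φ) []
      (subst (λ N → Factor N (τ σ z w ⟨ markTerm z (haystack φ) ⟩)) (mark-needle σ z w (needle φ) (z∉ψ ∘ vars-needle-instantiate ψ ℓ η)) f))
    where
    rep = proj₂ bound σ [] (σ z) σ⊨φ z≤n (proj₁ recognises (lang-instantiate-⊆ ψ ℓ η z (σ∈ z)))
    w = v rep ^ j rep ++ p rep
    w∈L : w ∈ L
    w∈L = ∈-PowerTail (𝒜 z) (v rep) (j rep) (p rep) (v≤K rep) (p≤K rep) (isAccepted rep)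
    w⇒z : ∀ T → Factor (σ ⟨ needle φ ⟩) (T ++ w) → Factor (σ ⟨ needle φ ⟩) (T ++ σ z)
    w⇒z = subst (λ N → ∀ T → Factor N (T ++ w) → Factor N (T ++ σ z)) (++-identityʳ _) (occurrence rep)
    in-lang : ∀ x → embed (σ ◁ z ↦ w) x ∈ lang (φ [ z / z #]) x
    in-lang x with x Fin.≟ z
    ... | yes refl = w , lang-instantiate-∉ ψ ℓ η z∉ψ (L⊆ w∈L) , refl
    ... | no  _    = σ x , σ∈ x , refl
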